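{- For all $n\ge 3$ and every $n$-component conjunctive network $f$, \[ \lambda(f)\le 2n-2, \] with equality if and only if the interaction graph of $f$ is isomorphic to $C_n^\circ$.
   Context: An $n$-component (Boolean) network is a function $f=(f_1,\dots,f_n):\{0,1\}^n\to\{0,1\}^n$. Write $[n]=\{1,\dots,n\}$. The interaction graph of $f$ is the directed graph on $[n]$ (loops allowed) with an edge from $j$ to $i$ iff $f_i$ depends on $x_j$, i.e. there exist $x,y$ differing only in component $j$ with $f_i(x)\ne f_i(y)$. The network $f$ is conjunctive if for every $i\in[n]$ there is $J_i\subseteq[n]$ with $f_i(x)=\bigwedge_{j\in J_i}x_j$ for all $x$ (with $f_i\equiv 1$ if $J_i=\emptyset$). For $i\in[n]$, $f^i(x):=(x_1,\dots,x_{i-1},f_i(x),x_{i+1},\dots,x_n)$, and for a word $w=i_1i_2\dots i_k$ over $[n]$, $f^w:=f^{i_k}\circ\cdots\circ f^{i_1}$ (identity for the empty word). A word $w$ fixes $f$ if $f^w(x)$ is a fixed point of $f$ for every $x$; $\lambda(f)$ is the minimum length of a word fixing $f$. $C_n$ is the directed cycle on $[n]$ with edges $i\to i+1$ for $1\le i<n$ and $n\to 1$; $C_n^\circ$ is obtained from $C_n$ by adding a loop $i\to i$ at every vertex $i\in[n]$. -}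

module Defs where

open import Data.Bool using (Bool)
open import Data.Bool.ListAction using (all)
open import Data.Fin using (Fin; toℕ)
open import Data.Fin.Permutation using (Permutation′; _⟨$⟩ʳ_)
open import Data.Fin.Subset using (Subset)
open import Data.Fin.Subset.Properties using (_∈?_)
open import Data.List using (List; length; foldl; filter; allFin)
open import Data.Nat using (ℕ; suc; _≤_)
open import Data.Product using (∃; ∃-syntax; _×_)
open import Data.Sum using (_⊎_)
open import Data.Vec using (Vec; lookup; _[_]≔_)
open import Function.Bundles using (_⇔_)
open import Level using (0ℓ)
open import Relation.Binary.Core using (Rel)
open import Relation.Binary.PropositionalEquality using (_≡_; _≢_)

State : ℕ → Set
State n = Vec Bool n

Network : ℕ → Set
Network n = State n → State n

Digraph : ℕ → Set₁
Digraph n = Rel (Fin n) 0ℓ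

component : ∀ {n} → Network n → Fin n → State n → Bool
component f i x = lookup (f x) i

DifferOnlyIn : ∀ {n} → Fin n → State n → State n → Set
DifferOnlyIn j x y =
  lookup x j ≢ lookup y j × (∀ k → k ≢ j → lookup x k ≡ lookup y k)

-- `interactionGraph f j i` is the edge from j to i: the source comes first.
interactionGraph : ∀ {n} → Network n → Digraph n
interactionGraph f j i =
  ∃[ x ] ∃[ y ] DifferOnlyIn j x y × component f i x ≢ component f i y

⋀ : ∀ {n} → Subset n → State n → Bool
⋀ {n} J x = all (lookup x) (filter (_∈? J) (allFin n))

Conjunctive : ∀ {n} → Network n → Set
Conjunctive f = ∀ i → ∃[ J ] (∀ x → component f i x ≡ ⋀ J x)

update : ∀ {n} → Network n → Fin n → State n → State n
update f i x = x [ i ]≔ component f i x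

-- The first letter of the word is applied first.
updateWord : ∀ {n} → Network n → List (Fin n) → State n → State n
updateWord f w x = foldl (λ y i → update f i y) x w

FixedPoint : ∀ {n} → Network n → State n → Set
FixedPoint f x = f x ≡ x

Fixes : ∀ {n} → List (Fin n) → Network n → Set
Fixes w f = ∀ x → FixedPoint f (updateWord f w x)

-- λ(f) is the minimum of a set of lengths that is empty for some networks, so
-- it is given by its graph: `FixingLength f k` says that λ(f) exists and is k.
FixingLength : ∀ {n} → Network n → ℕ → Set
FixingLength f k =
  (∃[ w ] Fixes w f × length w ≡ k) × (∀ w → Fixes w f → k ≤ length w)

-- Vertices are numbered from 0.
Cycle : ∀ n → Digraph n
Cycle n i j = toℕ j ≡ suc (toℕ i) ⊎ (suc (toℕ i) ≡ n × toℕ j ≡ 0)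

LoopedCycle : ∀ n → Digraph n
LoopedCycle n i j = Cycle n i j ⊎ i ≡ j

_≅_ : ∀ {n} → Digraph n → Digraph n → Set
_≅_ {n} G H =
  ∃ λ (σ : Permutation′ n) → ∀ i j → G i j ⇔ H (σ ⟨$⟩ʳ i) (σ ⟨$⟩ʳ j)

infix 4 _≅_

-- Write j ⟶ i when x_j is a factor of f_i. A tree of edges oriented towards a root r, updated from
-- the leaves to the root, gathers at r the conjunction of all values met, and if x_r is then 1 all
-- these values are 1; the leaves of the tree need no update. If instead x_r is 0, updating along a
-- tree oriented away from r spreads this 0. On a strongly connected network this takes
-- (n - ℓ) + (n - 1) updates, where ℓ is the number of leaves of the first tree. Two leaves are
-- possible as soon as some vertex has two in-neighbours other than itself; otherwise the graph is a
-- cycle with some loops, and a vertex without loop merely copies its predecessor, which again saves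
-- an update. If the graph is not strongly connected, its strong components are treated one after
-- the other from the sources on. Conversely, on the looped cycle let j be the letter of the word
-- whose first occurrence comes last, and start with a single 0 at the predecessor of j: nothing
-- moves before that occurrence, by which n letters have been read, and n - 2 more are needed.
module Submission where

open import Defs
import Data.Bool as Bool
open import Data.Bool using (Bool; true; false)
open import Data.Bool.ListAction using (all)
open import Data.Empty using (⊥-elim)
open import Data.Fin using (Fin; toℕ; fromℕ; fromℕ<; inject₁; cast)
open import Data.Fin.Permutation using (Permutation′; permutation; _⟨$⟩ʳ_; _⟨$⟩ˡ_; inverseˡ; inverseʳ)
open import Data.Fin.Properties using (_≟_; injective⇒≤; toℕ-inject₁; toℕ-fromℕ; toℕ<n;
  toℕ-injective; cast-is-id; cast-involutive)
  renaming (any? to anyFin?)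
import Data.Fin.Subset as Subset
open import Data.Fin.Subset.Properties using () renaming (_∈?_ to _∈ₛ?_)
open import Data.List using (List; []; _∷_; _++_; length; filter; allFin)
import Data.List as List
open import Data.List.Membership.Propositional using (find; lose)
open import Data.List.Membership.Propositional.Properties
  using (∈-allFin; ∈-lookup; ∈-filter⁺; ∈-filter⁻; ∈-++⁺ˡ; ∈-++⁺ʳ; ∈-++⁻)
open import Data.List.Properties using (length-tabulate; length-++; ++-assoc; foldl-++; filter-notAll)
open import Data.List.Relation.Binary.Subset.Propositional using (_⊆_)
import Data.List.Relation.Unary.All as All
open import Data.List.Relation.Unary.All using ([]; _∷_)
open import Data.List.Relation.Unary.All.Properties using (¬All⇒Any¬; ¬Any⇒All¬)
open import Data.List.Relation.Unary.AllPairs using ([]; _∷_)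
import Data.List.Relation.Unary.Any as Any
open import Data.List.Relation.Unary.Any using (here; there; index)
open import Data.List.Relation.Unary.Any.Properties using (lookup-index)
open import Data.List.Relation.Unary.Unique.Propositional using (Unique)
import Data.List.Relation.Unary.Unique.Propositional.Properties as Unique
open import Data.Nat using (ℕ; zero; suc; _+_; _*_; _∸_; _≤_; z≤n; s≤s)
open import Data.Nat.Properties hiding (_≟_)
open import Data.Nat.Tactic.RingSolver using (solve-∀)
open import Data.Product using (∃; ∃-syntax; _×_; _,_; proj₁; proj₂)
open import Data.Sum using (_⊎_; inj₁; inj₂; [_,_]′)
open import Data.Vec using ([]; _∷_; lookup; replicate; _[_]≔_)
open import Data.Vec.Properties using (lookup∘update; lookup∘update′; lookup-replicate; ≡-dec)
open import Data.Vec.Relation.Binary.Pointwise.Extensional using (ext; Pointwise-≡⇒≡)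
open import Function using (_∘_; flip; id)
open import Function.Bundles using (_⇔_; mk⇔; Equivalence)
open import Level using (0ℓ)
open import Relation.Binary.Core using (Rel)
open import Relation.Binary.Definitions using (Decidable)
open import Relation.Binary.PropositionalEquality
  using (_≡_; _≢_; refl; sym; trans; cong; subst; subst₂)
open import Relation.Nullary using (¬_; Dec; yes; no; contradiction; ¬?)
open import Relation.Nullary.Decidable using (_×-dec_; map′; decidable-stable)
open import Relation.Unary using (Pred)

private variable
  n : ℕ

-- Repetition-free lists and counting in `Fin n`.

module _ {n : ℕ} where
  open import Data.List.Membership.DecPropositional (_≟_ {n}) public
    using (_∈_; _∉_; _∈?_)

lookup-injective : {A : Set} {xs : List A} → Unique xs →
  ∀ i j → List.lookup xs i ≡ List.lookup xs j → i ≡ j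
lookup-injective (_ ∷ _) Fin.zero Fin.zero _ = refl
lookup-injective (x∉ ∷ _) Fin.zero (Fin.suc j) eq =
  contradiction eq (All.lookup x∉ (∈-lookup j))
lookup-injective (x∉ ∷ _) (Fin.suc i) Fin.zero eq =
  contradiction (sym eq) (All.lookup x∉ (∈-lookup i))
lookup-injective (_ ∷ u) (Fin.suc i) (Fin.suc j) eq = cong Fin.suc (lookup-injective u i j eq)

length-mono-⊆ : {A : Set} {xs ys : List A} → Unique xs → xs ⊆ ys → length xs ≤ length ys
length-mono-⊆ {xs = xs} {ys} u xs⊆ys = injective⇒≤ λ {i} {j} eq →
  lookup-injective u i j
    (trans (lookup-index (xs⊆ys (∈-lookup i)))
    (trans (cong (List.lookup ys) eq)
           (sym (lookup-index (xs⊆ys (∈-lookup j))))))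

∷-unique : {A : Set} {z : A} {L : List A} → ¬ Any.Any (z ≡_) L → Unique L → Unique (z ∷ L)
∷-unique z∉L u = ¬Any⇒All¬ _ z∉L ∷ u

unique⇒length≤n : {xs : List (Fin n)} → Unique xs → length xs ≤ n
unique⇒length≤n u =
  ≤-trans (length-mono-⊆ u (λ {v} _ → ∈-allFin v)) (≤-reflexive (length-tabulate id))

full⇒n≤length : {xs : List (Fin n)} → (∀ v → v ∈ xs) → n ≤ length xs
full⇒n≤length full =
  ≤-trans (≤-reflexive (sym (length-tabulate id)))
          (length-mono-⊆ (Unique.allFin⁺ _) (λ {v} _ → full v))

⊆-or-escapes : (xs ys : List (Fin n)) → xs ⊆ ys ⊎ ∃[ v ] v ∈ xs × v ∉ ys
⊆-or-escapes xs ys with All.all? (_∈? ys) xs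
... | yes all = inj₁ (All.lookup all)
... | no ¬all = inj₂ (find (¬All⇒Any¬ (_∈? ys) xs ¬all))

full-or-misses : (xs : List (Fin n)) → (∀ v → v ∈ xs) ⊎ ∃[ v ] v ∉ xs
full-or-misses xs with ⊆-or-escapes (allFin _) xs
... | inj₁ sub = inj₁ λ v → sub (∈-allFin v)
... | inj₂ (v , _ , v∉xs) = inj₂ (v , v∉xs)

-- Exhaustive search over states and words, and least numbers.

allStates? : {P : Pred (State n) 0ℓ} → (∀ x → Dec (P x)) → Dec (∀ x → P x)
allStates? {zero} P? = map′ (λ { p [] → p }) (λ p → p []) (P? [])
allStates? {suc n} P? = map′
  (λ { (t , _) (true ∷ x) → t x ; (_ , f) (false ∷ x) → f x })
  (λ p → (λ x → p (true ∷ x)) , λ x → p (false ∷ x))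
  (allStates? (λ x → P? (true ∷ x)) ×-dec allStates? (λ x → P? (false ∷ x)))

anyWord? : ∀ k {P : Pred (List (Fin n)) 0ℓ} → (∀ w → Dec (P w)) → Dec (∃[ w ] P w × length w ≡ k)
anyWord? zero P? = map′ (λ p → [] , p , refl) (λ { ([] , p , _) → p }) (P? [])
anyWord? (suc k) P? = map′
  (λ (i , w , p , e) → i ∷ w , p , cong suc e)
  (λ { (i ∷ w , p , e) → i , w , p , suc-injective e })
  (anyFin? λ i → anyWord? k λ w → P? (i ∷ w))

minimum : {P : Pred ℕ 0ℓ} → (∀ k → Dec (P k)) → ∀ m → P m → ∃[ k ] P k × (∀ j → P j → k ≤ j)
minimum P? m p with P? 0
minimum P? m p | yes p₀ = 0 , p₀ , λ _ _ → z≤n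
minimum P? zero p | no ¬p₀ = contradiction p ¬p₀
minimum P? (suc m) p | no ¬p₀ with minimum (P? ∘ suc) m p
... | k , pk , least = suc k , pk , λ
  { zero p₀ → contradiction p₀ ¬p₀ ; (suc j) pj → s≤s (least j pj) }

-- The directed cycle.

cycle-pred : (q : Fin n) → ∃[ p ] Cycle n p q
cycle-pred {suc m} Fin.zero = fromℕ m , inj₂ (cong suc (toℕ-fromℕ m) , refl)
cycle-pred (Fin.suc q) = inject₁ q , inj₁ (cong suc (sym (toℕ-inject₁ q)))

cycle-irrefl : {k : Fin n} → 2 ≤ n → ¬ Cycle n k k
cycle-irrefl _ (inj₁ e) = 1+n≢n (sym e)
cycle-irrefl 2≤n (inj₂ (e , k≡0)) =
  contradiction (≤-trans 2≤n (≤-reflexive (trans (sym e) (cong suc k≡0)))) λ { (s≤s ()) }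

cycle-out-unique : {a b c : Fin n} → Cycle n a b → Cycle n a c → b ≡ c
cycle-out-unique (inj₁ b≡) (inj₁ c≡) = toℕ-injective (trans b≡ (sym c≡))
cycle-out-unique {b = b} (inj₁ b≡) (inj₂ (e , _)) =
  contradiction (trans b≡ e) (<⇒≢ (toℕ<n b))
cycle-out-unique {c = c} (inj₂ (e , _)) (inj₁ c≡) =
  contradiction (trans c≡ e) (<⇒≢ (toℕ<n c))
cycle-out-unique (inj₂ (_ , b≡)) (inj₂ (_ , c≡)) = toℕ-injective (trans b≡ (sym c≡))

cast-loopedCycle : ∀ {m} (e : m ≡ n) {a b} →
  LoopedCycle m a b ⇔ LoopedCycle n (cast e a) (cast e b)
cast-loopedCycle refl {a} {b} rewrite cast-is-id refl a | cast-is-id refl b = mk⇔ id id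

-- Search trees

Closed : Rel (Fin n) 0ℓ → Pred (Fin n) 0ℓ → Set
Closed R C = ∀ {y z} → C y → R y z → C z

-- Reachability without paths: a set closed under `R` that contains some vertex contains all. As
-- that vertex is arbitrary, this is strong connectivity.
Connected : Rel (Fin n) 0ℓ → Set₁
Connected {n} R = ∀ (C : Pred (Fin n) 0ℓ) {v} → C v → Closed R C → ∀ u → C u

-- A tree listed with its newest vertex first, each new vertex hanging on an older one. With
-- `flip R` in place of `R` its edges lead towards `r`, and the list read as a word treats children
-- before parents and `r` last.
data Growth (R : Rel (Fin n) 0ℓ) (r : Fin n) : List (Fin n) → Set where
  root : Growth R r (r ∷ [])
  grow : ∀ {L y z} → Growth R r L → y ∈ L → R y z → z ∉ L → Growth R r (z ∷ L)

module _ {R : Rel (Fin n) 0ℓ} where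

  root∈ : ∀ {r L} → Growth R r L → r ∈ L
  root∈ root = here refl
  root∈ (grow g _ _ _) = there (root∈ g)

  growth-unique : ∀ {r L} → Growth R r L → Unique L
  growth-unique root = [] ∷ []
  growth-unique (grow g _ _ z∉L) = ∷-unique z∉L (growth-unique g)

  growth⊆closed : ∀ {r L} (C : Pred (Fin n) 0ℓ) → Growth R r L → C r →
    (∀ {y z} → C y → R y z → z ∈ L → C z) → ∀ {u} → u ∈ L → C u
  growth⊆closed C root Cr _ (here refl) = Cr
  growth⊆closed C (grow g y∈L y→z _) Cr step (here refl) =
    step (growth⊆closed C g Cr (λ c e z∈ → step c e (there z∈)) y∈L) y→z (here refl)
  growth⊆closed C (grow g _ _ _) Cr step (there u∈L) =
    growth⊆closed C g Cr (λ c e z∈ → step c e (there z∈)) u∈L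

  closed⇒root : ∀ {r L v} (C : Pred (Fin n) 0ℓ) → Growth R r L → Closed (flip R) C →
    v ∈ L → C v → C r
  closed⇒root C root _ (here refl) Cv = Cv
  closed⇒root C (grow g y∈L y→z _) cl (here refl) Cv = closed⇒root C g cl y∈L (cl Cv y→z)
  closed⇒root C (grow g _ _ _) cl (there v∈L) Cv = closed⇒root C g cl v∈L Cv

  -- The first vertex added after the root can only hang on the root.
  first-child : ∀ {r L} → Growth R r L → L ≡ r ∷ [] ⊎ ∃[ a ] a ≢ r × a ∈ L × R r a
  first-child root = inj₁ refl
  first-child (grow g y∈L y→z z∉L) with first-child g
  ... | inj₂ (a , a≢r , a∈L , r→a) = inj₂ (a , a≢r , there a∈L , r→a)
  first-child (grow g (here refl) y→z z∉L) | inj₁ refl =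
    inj₂ (_ , (λ { refl → z∉L (here refl) }) , here refl , y→z)

  parent : ∀ {r L m} → Growth R r L → m ∈ L → m ≡ r ⊎ ∃[ y ] y ∈ L × R y m
  parent root (here refl) = inj₁ refl
  parent (grow _ y∈L y→z _) (here refl) = inj₂ (_ , there y∈L , y→z)
  parent (grow g _ _ _) (there m∈L) with parent g m∈L
  ... | inj₁ m≡r = inj₁ m≡r
  ... | inj₂ (y , y∈L , y→m) = inj₂ (y , there y∈L , y→m)

-- From any vertex of `C` the tree `K` leads to `r`, and from `r` the tree `M` leads everywhere.
spanning⇒connected : {R : Rel (Fin n) 0ℓ} {r : Fin n} {K M : List (Fin n)} →
  Growth (flip R) r K → Growth R r M → (∀ v → v ∈ K) → (∀ v → v ∈ M) → Connected R
spanning⇒connected gK gM fullK fullM C {v} Cv cl u =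
  growth⊆closed C gM (closed⇒root C gK cl (fullK v) Cv) (λ c e _ → cl c e) (fullM u)

-- Go up from `v` to the last vertex, wrap around to 0, and go up again to `u`.
cycle-connected : Connected (Cycle n)
cycle-connected {suc m} C {v} Cv closed u = climb (toℕ u) C0 (sym (+-identityʳ _))
  where
  climb : ∀ k {a b : Fin (suc m)} → C a → toℕ b ≡ k + toℕ a → C b
  climb zero {a} {b} Ca e with refl ← toℕ-injective {i = b} {a} e = Ca
  climb (suc k) {b = Fin.suc b} Ca e =
    closed (climb k {b = inject₁ b} Ca (trans (toℕ-inject₁ b) (suc-injective e)))
           (inj₁ (cong suc (sym (toℕ-inject₁ b))))
  C0 : C Fin.zero
  C0 = closed
    (climb (m ∸ toℕ v) {b = fromℕ m} Cv
      (trans (toℕ-fromℕ m) (sym (m∸n+n≡m (≤-pred (toℕ<n v))))))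
    (inj₂ (cong suc (toℕ-fromℕ m) , refl))

module _ {R : Rel (Fin n) 0ℓ} (R? : Decidable R) (P : Pred (List (Fin n)) 0ℓ)
  (step : ∀ {L y z} → P L → y ∈ L → R y z → z ∉ L → P (z ∷ L)) where

  private
    go : ∀ m {L} → n ≤ m + length L → P L → Unique L →
      ∃[ L′ ] P L′ × Unique L′ × L ⊆ L′ × Closed R (_∈ L′)
    go m {L} bound p u
      with anyFin? (λ z → ¬? (z ∈? L) ×-dec Any.any? (λ y → R? y z) L)
    ... | no none = L , p , u , id , closed
      where
      closed : Closed R (_∈ L)
      closed {y} {z} y∈L y→z with z ∈? L
      ... | yes z∈L = z∈L
      ... | no z∉L = contradiction (z , z∉L , lose y∈L y→z) none
    go zero bound p u | yes (z , z∉L , _) =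
      contradiction (unique⇒length≤n (∷-unique z∉L u)) (<⇒≱ (s≤s bound))
    go (suc m) bound p u | yes (z , z∉L , y→z) with find y→z
    ... | y , y∈L , e
      with go m (≤-trans bound (≤-reflexive (sym (+-suc m _)))) (step p y∈L e z∉L) (∷-unique z∉L u)
    ... | L′ , p′ , u′ , sub , cl = L′ , p′ , u′ , sub ∘ there , cl

  -- Vertices are added greedily while an edge leaves the list; the fuel suffices since a
  -- repetition-free list has at most `n` entries. As the invariant `P` is arbitrary, the same loop
  -- builds trees, skeletons and chains.
  saturate : ∀ {L} → P L → Unique L → ∃[ L′ ] P L′ × Unique L′ × L ⊆ L′ × Closed R (_∈ L′)
  saturate = go n (m≤m+n n _)

-- A tree towards `r` on the vertices `L`: those in `inner` are updated while gathering, and the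
-- others are leaves feeding them. At least `c` updates are spared.
record Skeleton (R : Rel (Fin n) 0ℓ) (r : Fin n) (c : ℕ) (L : List (Fin n)) : Set where
  field
    inner   : List (Fin n)
    growth  : Growth (flip R) r inner
    covered : ∀ {u} → u ∈ L → u ∈ inner ⊎ ∃[ y ] y ∈ inner × R u y
    size    : length inner + c ≤ length L

-- A vertex attached to an inner vertex is one more leaf; attached to a leaf, it replaces that leaf,
-- which becomes inner. So the count `c` never drops.
skeleton-step : {R : Rel (Fin n) 0ℓ} {r : Fin n} {c : ℕ} {L : List (Fin n)} {y z : Fin n} →
  Skeleton R r c L → y ∈ L → R z y → Skeleton R r c (z ∷ L)
skeleton-step {y = y} s y∈L z→y with y ∈? Skeleton.inner s
... | yes y∈I = record
  { inner   = inner
  ; growth  = growth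
  ; covered = λ { (here refl) → inj₂ (_ , y∈I , z→y) ; (there u∈L) → covered u∈L }
  ; size    = m≤n⇒m≤1+n size
  }
  where open Skeleton s
... | no y∉I with Skeleton.covered s y∈L
... | inj₁ y∈I = contradiction y∈I y∉I
... | inj₂ (y′ , y′∈I , y→y′) = record
  { inner   = _ ∷ inner
  ; growth  = grow growth y′∈I y→y′ y∉I
  ; covered = λ
    { (here refl) → inj₂ (_ , here refl , z→y)
    ; (there u∈L) → [ inj₁ ∘ there , (λ (v , v∈I , e) → inj₂ (v , there v∈I , e)) ]′ (covered u∈L) }
  ; size    = s≤s size
  }
  where open Skeleton s

-- Dynamics of conjunctive networks

all⁺ : {A : Set} (p : A → Bool) {xs : List A} → All.All (λ a → p a ≡ true) xs → all p xs ≡ true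
all⁺ p [] = refl
all⁺ p (pa ∷ ps) rewrite pa = all⁺ p ps

all⁻ : {A : Set} (p : A → Bool) (xs : List A) → all p xs ≡ true → All.All (λ a → p a ≡ true) xs
all⁻ p [] _ = []
all⁻ p (a ∷ xs) eq with p a in pa
... | true = pa ∷ all⁻ p xs eq

all-false⁻ : {A : Set} (p : A → Bool) (xs : List A) → all p xs ≡ false →
  Any.Any (λ a → p a ≡ false) xs
all-false⁻ p (a ∷ xs) eq with p a in pa
... | true = there (all-false⁻ p xs eq)
... | false = here pa

true-or-false : ∀ b → b ≡ true ⊎ b ≡ false
true-or-false true = inj₁ refl
true-or-false false = inj₂ refl

true≢false : {b : Bool} → b ≡ true → b ≡ false → {A : Set} → A
true≢false refl ()

module _ {n : ℕ} (f : Network n) (conj : Conjunctive f) where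

  infix 4 _⟶_

  _⟶_ : Digraph n
  j ⟶ i = j Subset.∈ proj₁ (conj i)

  _⟶?_ : Decidable _⟶_
  j ⟶? i = j ∈ₛ? proj₁ (conj i)

  run : List (Fin n) → State n → State n
  run w x = updateWord f w x

  FixedOn : List (Fin n) → State n → Set
  FixedOn S x = ∀ {i} → i ∈ S → component f i x ≡ lookup x i

  PredClosed : List (Fin n) → Set
  PredClosed S = Closed (flip _⟶_) (_∈ S)

  component-true⁺ : ∀ {x i} → (∀ {j} → j ⟶ i → lookup x j ≡ true) → component f i x ≡ true
  component-true⁺ {x} {i} ones = trans (proj₂ (conj i) x)
    (all⁺ (lookup x) (All.tabulate λ j∈ → ones (proj₂ (∈-filter⁻ (_∈ₛ? _) {xs = allFin n} j∈))))

  component-true⁻ : ∀ {x i j} → component f i x ≡ true → j ⟶ i → lookup x j ≡ true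
  component-true⁻ {x} {i} eq j→i =
    All.lookup (all⁻ (lookup x) _ (trans (sym (proj₂ (conj i) x)) eq))
      (∈-filter⁺ (_∈ₛ? _) (∈-allFin _) j→i)

  component-false⁻ : ∀ {x i} → component f i x ≡ false → ∃[ j ] j ⟶ i × lookup x j ≡ false
  component-false⁻ {x} {i} eq
    with j , j∈ , xj ← find (all-false⁻ (lookup x) _ (trans (sym (proj₂ (conj i) x)) eq))
    = j , proj₂ (∈-filter⁻ (_∈ₛ? _) {xs = allFin n} j∈) , xj

  component-false⁺ : ∀ {x i j} → j ⟶ i → lookup x j ≡ false → component f i x ≡ false
  component-false⁺ {x} {i} j→i xj with true-or-false (component f i x)
  ... | inj₁ t = true≢false (component-true⁻ t j→i) xj
  ... | inj₂ ff = ff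

  component-cong : ∀ {x y i} → (∀ {j} → j ⟶ i → lookup x j ≡ lookup y j) →
    component f i x ≡ component f i y
  component-cong {x} {y} {i} eq with true-or-false (component f i x)
  ... | inj₁ t = trans t (sym (component-true⁺ λ j→i → trans (sym (eq j→i)) (component-true⁻ t j→i)))
  ... | inj₂ ff with j , j→i , xj ← component-false⁻ ff =
    trans ff (sym (component-false⁺ j→i (trans (sym (eq j→i)) xj)))

  -- At the all-ones state, switching off `j` alone switches off component `i`, so every factor of
  -- the conjunction is a genuine dependence.
  ⟶⇔interactionGraph : ∀ j i → j ⟶ i ⇔ interactionGraph f j i
  ⟶⇔interactionGraph j i = mk⇔ to from
    where
    ones : State n
    ones = replicate n true

    to : j ⟶ i → interactionGraph f j i
    to j→i = ones , ones [ j ]≔ false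
      , ( (λ eq → true≢false (lookup-replicate j true)
                    (trans eq (lookup∘update j ones false)))
        , λ k k≢j → sym (lookup∘update′ k≢j ones false))
      , λ eq → true≢false (component-true⁺ λ {k} _ → lookup-replicate k true)
                 (trans eq (component-false⁺ j→i (lookup∘update j ones false)))

    from : interactionGraph f j i → j ⟶ i
    from (x , y , (_ , agree) , differ) = decidable-stable (j ⟶? i) λ j↛i →
      differ (component-cong λ {k} k→i → agree k λ { refl → j↛i k→i })

  update-self : ∀ i x → lookup (update f i x) i ≡ component f i x
  update-self i x = lookup∘update i x _

  update-other : ∀ {k i} → k ≢ i → ∀ x → lookup (update f i x) k ≡ lookup x k
  update-other k≢i x = lookup∘update′ k≢i x _

  run-other : ∀ w {k} → k ∉ w → ∀ x → lookup (run w x) k ≡ lookup x k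
  run-other [] _ x = refl
  run-other (i ∷ w) k∉w x =
    trans (run-other w (k∉w ∘ there) _) (update-other (λ { refl → k∉w (here refl) }) x)

  run-++ : ∀ u v x → run (u ++ v) x ≡ run v (run u x)
  run-++ u v x = foldl-++ _ x u v

  update-fixedOn : ∀ {S x} → FixedOn S x → ∀ k {i} → i ∈ S → lookup (update f k x) i ≡ lookup x i
  update-fixedOn {x = x} fixed k {i} i∈S with i ≟ k
  ... | yes refl = trans (update-self i x) (fixed i∈S)
  ... | no i≢k = update-other i≢k x

  fixedOn-cong : ∀ {S x y} → PredClosed S → (∀ {i} → i ∈ S → lookup y i ≡ lookup x i) →
    FixedOn S x → FixedOn S y
  fixedOn-cong closed eq fixed i∈S =
    trans (component-cong λ j→i → eq (closed i∈S j→i)) (trans (fixed i∈S) (sym (eq i∈S)))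

  -- Components in `S` read only components in `S`, so once stationary they stay frozen whatever is
  -- updated.
  run-fixedOn : ∀ {S x} → PredClosed S → FixedOn S x → ∀ w {i} → i ∈ S →
    lookup (run w x) i ≡ lookup x i
  run-fixedOn closed fixed [] i∈S = refl
  run-fixedOn closed fixed (k ∷ w) i∈S =
    trans (run-fixedOn closed (fixedOn-cong closed (update-fixedOn fixed k) fixed) w i∈S)
          (update-fixedOn fixed k i∈S)

  fixedOn-run : ∀ {S x} → PredClosed S → FixedOn S x → ∀ w → FixedOn S (run w x)
  fixedOn-run closed fixed w = fixedOn-cong closed (run-fixedOn closed fixed w) fixed

  ones⇒fixedOn : ∀ {S x} → PredClosed S → (∀ {i} → i ∈ S → lookup x i ≡ true) → FixedOn S x
  ones⇒fixedOn closed ones i∈S =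
    trans (component-true⁺ λ j→i → ones (closed i∈S j→i)) (sym (ones i∈S))

  fixedOn⇒fixedPoint : ∀ {S x} → (∀ v → v ∈ S) → FixedOn S x → FixedPoint f x
  fixedOn⇒fixedPoint full fixed = Pointwise-≡⇒≡ (ext λ v → fixed (full v))

  -- Induction on the tree. The newest vertex `z` is updated first and then left alone, so its
  -- parent `y` reads its new value; the claim about in-neighbours outside `I` is what carries the
  -- value 1 from `y` back to `z`.
  gather-true : ∀ {r I} → Growth (flip _⟶_) r I → ∀ x → lookup (run I x) r ≡ true →
    ∀ {i} → i ∈ I → lookup (run I x) i ≡ true × (∀ {j} → j ⟶ i → j ∉ I → lookup x j ≡ true)
  gather-true {r} root x eq (here refl) =
    eq , λ j→i _ → component-true⁻ (trans (sym (update-self r x)) eq) j→i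
  gather-true (grow {L} {y} {z} g y∈L z→y z∉L) x eq (here refl) =
    trans (run-other L z∉L _) z-true ,
    λ j→z _ → component-true⁻ (trans (sym (update-self z x)) z-true) j→z
    where
    z-true : lookup (update f z x) z ≡ true
    z-true = proj₂ (gather-true g (update f z x) eq y∈L) z→y z∉L
  gather-true (grow g _ _ _) x eq (there i∈L) with gather-true g _ eq i∈L
  ... | i-true , outside =
    i-true , λ j→i j∉ → trans (sym (update-other (λ { refl → j∉ (here refl) }) x))
                              (outside j→i (j∉ ∘ there))

  gather-sources-true : ∀ {r I} → Growth (flip _⟶_) r I → ∀ x → lookup (run I x) r ≡ true →
    ∀ {i j} → i ∈ I → j ⟶ i → lookup (run I x) j ≡ true
  gather-sources-true {I = I} g x eq {j = j} i∈I j→i with j ∈? I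
  ... | yes j∈I = proj₁ (gather-true g x eq j∈I)
  ... | no j∉I = trans (run-other I j∉I x) (proj₂ (gather-true g x eq i∈I) j→i j∉I)

  -- The root is updated last, so some in-neighbour was 0 at that moment; if it is the root itself,
  -- its new value 0 serves. This justifies the 0 of the root, which has no parent in the scattering
  -- tree.
  gather-false : ∀ {r I} → Growth (flip _⟶_) r I → ∀ x → lookup (run I x) r ≡ false →
    ∃[ j ] j ⟶ r × lookup (run I x) j ≡ false
  gather-false {r} root x eq with component-false⁻ (trans (sym (update-self r x)) eq)
  ... | j , j→r , xj with j ≟ r
  ... | yes refl = j , j→r , eq
  ... | no j≢r = j , j→r , trans (update-other j≢r x) xj
  gather-false (grow g _ _ _) x eq = gather-false g _ eq

  skeleton-true : ∀ {r c L} (s : Skeleton _⟶_ r c L) → ∀ x →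
    lookup (run (Skeleton.inner s) x) r ≡ true →
    ∀ {i} → i ∈ L → lookup (run (Skeleton.inner s) x) i ≡ true
  skeleton-true s x eq i∈L with Skeleton.covered s i∈L
  ... | inj₁ i∈I = proj₁ (gather-true (Skeleton.growth s) x eq i∈I)
  ... | inj₂ (y , y∈I , i→y) = gather-sources-true (Skeleton.growth s) x eq y∈I i→y

  -- Opposite to the order of the list: parents come before children. The root, whose 0 is to be
  -- spread, needs no update, which saves a letter.
  spread : ∀ {r M} → Growth _⟶_ r M → List (Fin n)
  spread root = []
  spread (grow {z = z} g _ _ _) = spread g ++ z ∷ []

  length-spread : ∀ {r M} (g : Growth _⟶_ r M) → suc (length (spread g)) ≡ length M
  length-spread root = refl
  length-spread (grow {z = z} g _ _ _) =
    cong suc (trans (length-++ (spread g)) (trans (+-comm _ 1) (length-spread g)))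

  spread-false : ∀ {r M} (g : Growth _⟶_ r M) → ∀ x → lookup x r ≡ false →
    ∀ {m} → m ∈ M → lookup (run (spread g) x) m ≡ false
  spread-false root x eq (here refl) = eq
  spread-false (grow {z = z} g y∈L y→z z∉L) x eq {m} m∈M rewrite run-++ (spread g) (z ∷ []) x
    with m ≟ z | m∈M
  ... | yes refl | _ = trans (update-self z (run (spread g) x)) (component-false⁺ y→z (spread-false g x eq y∈L))
  ... | no m≢z | here m≡z = contradiction m≡z m≢z
  ... | no m≢z | there m∈L = trans (update-other m≢z (run (spread g) x)) (spread-false g x eq m∈L)

  extend : ∀ {S K r I M w} → PredClosed S → PredClosed (K ++ S) →
    (∀ x → FixedOn S (run w x)) →
    Growth (flip _⟶_) r I → (o : Growth _⟶_ r M) → K ⊆ M →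
    (∀ x → lookup (run I (run w x)) r ≡ true →
           FixedOn (K ++ S) (run (spread o) (run I (run w x)))) →
    ∀ x → FixedOn (K ++ S) (run (w ++ I ++ spread o) x)
  extend {S} {K} {r} {I} {M} {w} closedS closed fixedS g o K⊆M good x {i} i∈
    rewrite run-++ w (I ++ spread o) x | run-++ I (spread o) (run w x)
    with true-or-false (lookup (run I (run w x)) r)
  ... | inj₁ t = good x t i∈
  ... | inj₂ ff with ∈-++⁻ K i∈
  ... | inj₂ i∈S = fixedOn-run closedS (fixedOn-run closedS (fixedS x) I) (spread o) i∈S
  ... | inj₁ i∈K = trans (component-false⁺ (proj₁ (proj₂ source)) (proj₂ (proj₂ source))) (sym (zeros i∈K))
    where
    x₂ = run I (run w x)
    zeros : ∀ {k} → k ∈ K → lookup (run (spread o) x₂) k ≡ false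
    zeros k∈K = spread-false o x₂ ff (K⊆M k∈K)
    source : ∃[ j ] j ⟶ i × lookup (run (spread o) x₂) j ≡ false
    source with parent o (K⊆M i∈K)
    ... | inj₂ (y , y∈M , y→i) = y , y→i , spread-false o x₂ ff y∈M
    ... | inj₁ refl with gather-false g (run w x) ff
    ... | j , j→r , xj with ∈-++⁻ K (closed i∈ j→r)
    ... | inj₁ j∈K = j , j→r , zeros j∈K
    ... | inj₂ j∈S = j , j→r ,
      trans (run-fixedOn closedS (fixedOn-run closedS (fixedS x) I) (spread o) j∈S) xj

  -- Peeling off source components

  -- Here `d` counts the letters saved against two per vertex of `S`; the additive form avoids
  -- truncated subtraction.
  record Fixing (d : ℕ) (S : List (Fin n)) : Set where
    field
      unique     : Unique S
      predClosed : PredClosed S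
      word       : List (Fin n)
      short      : length word + d ≤ 2 * length S
      fixes      : ∀ x → FixedOn S (run word x)

  -- Serves for source components that are single vertices without loop: they reach 1 from every
  -- state at one letter each.
  record Raising (S : List (Fin n)) : Set where
    field
      unique     : Unique S
      predClosed : PredClosed S
      word       : List (Fin n)
      short      : length word ≤ length S
      ones       : ∀ x {i} → i ∈ S → lookup (run word x) i ≡ true

  -- A strongly connected set whose outside in-neighbours all lie in `S`; two trees on the same
  -- vertices, one towards `r` and one away from it, witness the connectivity.
  record Block (S : List (Fin n)) : Set where
    field
      {r}        : Fin n
      {K} {M}    : List (Fin n)
      gather     : Growth (flip _⟶_) r K
      scatter    : Growth _⟶_ r M
      K⊆M        : K ⊆ M
      M⊆K        : M ⊆ K
      disjoint   : ∀ {v} → v ∈ K → v ∉ S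
      predClosed : PredClosed (K ++ S)

    unique : Unique S → Unique (K ++ S)
    unique u = Unique.++⁺ (growth-unique gather) u λ (v∈K , v∈S) → disjoint v∈K v∈S

    size : length M ≤ length K
    size = length-mono-⊆ (growth-unique scatter) M⊆K

  saturate-within : {R : Digraph n} → Decidable R → ∀ T {r} → r ∈ T →
    ∃[ L ] Growth R r L × L ⊆ T × (∀ {y z} → y ∈ L → R y z → z ∈ T → z ∈ L)
  saturate-within {R} R? T {r} r∈T
    with L , (g , L⊆T) , _ , _ , closed ← saturate
           (λ y z → R? y z ×-dec (z ∈? T)) (λ L → Growth R r L × L ⊆ T)
           (λ { (g , sub) y∈L (e , z∈T) z∉L →
                grow g y∈L e z∉L , λ { (here refl) → z∈T ; (there v∈L) → sub v∈L } })
           (root , λ { (here refl) → r∈T }) ([] ∷ [])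
    = L , g , L⊆T , λ y∈L e z∈T → closed y∈L (e , z∈T)

  predClosed-within : ∀ {S T K} → PredClosed S → PredClosed (T ++ S) → K ⊆ T →
    (∀ {y z} → y ∈ K → z ⟶ y → z ∈ T → z ∈ K) → PredClosed (K ++ S)
  predClosed-within {S} {T} {K} closedS closedT K⊆T closedK y∈ z→y with ∈-++⁻ K y∈
  ... | inj₂ y∈S = ∈-++⁺ʳ K (closedS y∈S z→y)
  ... | inj₁ y∈K with ∈-++⁻ T (closedT (∈-++⁺ˡ (K⊆T y∈K)) z→y)
  ... | inj₂ z∈S = ∈-++⁺ʳ K z∈S
  ... | inj₁ z∈T = ∈-++⁺ˡ (closedK y∈K z→y z∈T)

  -- A nonempty T whose sources lie in T ∪ S either is strongly connected or contains a strictly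
  -- smaller such set: the ancestors of t in T, or the complement of its descendants.

  findBlock : ∀ {S} → PredClosed S → ∀ m T {t} → t ∈ T → length T ≤ m → Unique T →
    (∀ {v} → v ∈ T → v ∉ S) → PredClosed (T ++ S) → Block S
  findBlock _ zero (_ ∷ _) _ () _ _ _
  findBlock {S} closedS (suc m) T {t} t∈T bound uT disj closedT
    with M , gM , M⊆T , closedM ← saturate-within _⟶?_ T t∈T
       | K , gK , K⊆T , closedK ← saturate-within (flip _⟶?_) T t∈T
    with ⊆-or-escapes T M | ⊆-or-escapes T K
  ... | inj₂ (v , v∈T , v∉M) | _ =
    findBlock closedS m (filter ∉M? T) (∈-filter⁺ ∉M? v∈T v∉M)
      (≤-pred (≤-trans (filter-notAll ∉M? T (lose t∈T λ t∉M → t∉M (root∈ gM))) bound))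
      (Unique.filter⁺ ∉M? uT)
      (λ u∈ → disj (proj₁ (∈-filter⁻ ∉M? {xs = T} u∈)))
      (predClosed-within closedS closedT (proj₁ ∘ ∈-filter⁻ ∉M? {xs = T}) λ y∈ z→y z∈T →
        let y∈T , y∉M = ∈-filter⁻ ∉M? {xs = T} y∈
        in ∈-filter⁺ ∉M? z∈T λ z∈M → y∉M (closedM z∈M z→y y∈T))
    where
    ∉M? : ∀ u → Dec (u ∉ M)
    ∉M? u = ¬? (u ∈? M)
  ... | inj₁ T⊆M | inj₂ (v , v∈T , v∉K) =
    findBlock closedS m K (root∈ gK)
      (≤-pred (≤-trans (length-mono-⊆ (∷-unique v∉K (growth-unique gK))
                          λ { (here refl) → v∈T ; (there u∈K) → K⊆T u∈K }) bound))
      (growth-unique gK) (disj ∘ K⊆T) (predClosed-within closedS closedT K⊆T closedK)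
  ... | inj₁ T⊆M | inj₁ T⊆K = record
    { gather = gK ; scatter = gM
    ; K⊆M = T⊆M ∘ K⊆T ; M⊆K = T⊆K ∘ M⊆T
    ; disjoint = disj ∘ K⊆T
    ; predClosed = predClosed-within closedS closedT K⊆T closedK
    }

  block : ∀ {S v} → PredClosed S → v ∉ S → Block S
  block {S} {v} closed v∉S = findBlock closed _ T (∈-filter⁺ _ (∈-allFin v) v∉S) ≤-refl
    (Unique.filter⁺ _ (Unique.allFin⁺ n)) (λ u∈ → proj₂ (∈-filter⁻ _ {xs = allFin n} u∈)) everything
    where
    T = filter (λ u → ¬? (u ∈? S)) (allFin n)
    everything : PredClosed (T ++ S)
    everything {z = z} _ _ with z ∈? S
    ... | yes z∈S = ∈-++⁺ʳ _ z∈S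
    ... | no z∉S = ∈-++⁺ˡ (∈-filter⁺ _ (∈-allFin z) z∉S)

  -- Of two letters per vertex of `K`, scattering spares the root and gathering spares `c` vertices;
  -- the `d` letters saved on `S` are kept.
  assemble : ∀ {S K r I M w c d} → Unique (K ++ S) → PredClosed S → PredClosed (K ++ S) →
    length w + d ≤ 2 * length S → length I + c ≤ length K → length M ≤ length K →
    (∀ x → FixedOn S (run w x)) →
    Growth (flip _⟶_) r I → (o : Growth _⟶_ r M) → K ⊆ M →
    (∀ x → lookup (run I (run w x)) r ≡ true →
           FixedOn (K ++ S) (run (spread o) (run I (run w x)))) →
    Fixing (suc (c + d)) (K ++ S)
  assemble {S} {K} {r} {I} {M} {w} {c} {d} u closedS closed w≤ I≤ M≤ fixesS g o K⊆M good = record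
    { unique = u ; predClosed = closed ; word = w ++ I ++ spread o
    ; short = begin
        length (w ++ I ++ spread o) + suc (c + d)
          ≡⟨ cong (_+ suc (c + d)) (trans (length-++ w) (cong (length w +_) (length-++ I))) ⟩
        (length w + (length I + length (spread o))) + suc (c + d)
          ≡⟨ regroup (length w) (length I) (length (spread o)) c d ⟩
        (length w + d) + ((length I + c) + suc (length (spread o)))
          ≤⟨ +-mono-≤ w≤ (+-mono-≤ I≤ (≤-trans (≤-reflexive (length-spread o)) M≤)) ⟩
        2 * length S + (length K + length K)
          ≡⟨ double (length S) (length K) ⟩
        2 * (length K + length S)
          ≡⟨ cong (2 *_) (sym (length-++ K)) ⟩
        2 * length (K ++ S) ∎
    ; fixes = extend {w = w} closedS closed fixesS g o K⊆M good
    }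
    where
    open ≤-Reasoning
    regroup : ∀ a b c d e → (a + (b + c)) + suc (d + e) ≡ (a + e) + ((b + d) + suc c)
    regroup = solve-∀
    double : ∀ a b → 2 * a + (b + b) ≡ 2 * (b + a)
    double = solve-∀

  Shortens : ℕ → Set
  Shortens d = ∃[ w ] Fixes w f × length w + d ≤ 2 * n

  weaken : ∀ {d e} → e ≤ d → Shortens d → Shortens e
  weaken e≤d (w , fixes , short) = w , fixes , ≤-trans (+-monoʳ-≤ (length w) e≤d) short

  shortens : ∀ {d S} → (∀ v → v ∈ S) → Fixing d S → Shortens d
  shortens full φ = word , (λ x → fixedOn⇒fixedPoint full (fixes x)) ,
    ≤-trans short (*-monoʳ-≤ 2 (unique⇒length≤n unique))
    where open Fixing φ

  -- Values in `S` may be 0, so all of `K` is updated while gathering: a leaf left alone could have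
  -- an in-neighbour at 0 in `S`. Only the root is spared in scattering.
  addBlock : ∀ {d S} → Fixing d S → (b : Block S) → Fixing (suc d) (Block.K b ++ S)
  addBlock φ b = assemble {w = word} (B.unique unique) predClosed B.predClosed short
    (≤-reflexive (+-identityʳ _)) B.size fixes B.gather B.scatter B.K⊆M
    λ x t → fixedOn-run B.predClosed (fixed x t) (spread B.scatter)
    where
    open Fixing φ
    module B = Block b
    fixed : ∀ x → lookup (run B.K (run word x)) B.r ≡ true →
      FixedOn (B.K ++ _) (run B.K (run word x))
    fixed x t i∈ with ∈-++⁻ B.K i∈
    ... | inj₂ i∈S = fixedOn-run predClosed (fixes x) B.K i∈S
    ... | inj₁ i∈K = trans (component-true⁺ (gather-sources-true B.gather _ t i∈K))
                           (sym (proj₁ (gather-true B.gather _ t i∈K)))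

  grown : ∀ {m S} (b : Block S) → n ≤ suc m + length S → n ≤ m + length (Block.K b ++ S)
  grown {m} {S} b bound = begin
    n                              ≤⟨ bound ⟩
    suc m + length S               ≡⟨ sym (+-suc m _) ⟩
    m + (1 + length S)             ≤⟨ +-monoʳ-≤ m (+-monoˡ-≤ (length S) (nonempty (root∈ gather))) ⟩
    m + (length K + length S)      ≡⟨ cong (m +_) (sym (length-++ K)) ⟩
    m + length (K ++ S)            ∎
    where
    open Block b
    open ≤-Reasoning
    nonempty : ∀ {v} {L : List (Fin n)} → v ∈ L → 1 ≤ length L
    nonempty (here _) = s≤s z≤n
    nonempty (there _) = s≤s z≤n

  complete : ∀ m {d S} → n ≤ m + length S → Fixing d S → Shortens d
  complete m {S = S} bound φ with full-or-misses S
  ... | inj₁ full = shortens full φ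
  complete zero bound φ | inj₂ (v , v∉S) =
    contradiction (unique⇒length≤n (∷-unique v∉S (Fixing.unique φ))) (<⇒≱ (s≤s bound))
  complete (suc m) bound φ | inj₂ (v , v∉S) =
    weaken (n≤1+n _) (complete m (grown {m} b bound) (addBlock φ b))
    where b = block (Fixing.predClosed φ) v∉S

  -- One further block saves one more letter, and the blocks after it lose nothing.
  complete-proper : ∀ {d S v} → v ∉ S → Fixing d S → Shortens (suc d)
  complete-proper v∉S φ = complete n (m≤m+n n _) (addBlock φ (block (Fixing.predClosed φ) v∉S))

  raising⇒fixing : ∀ {S} → Raising S → Fixing (length S) S
  raising⇒fixing {S} ρ = record
    { unique = unique ; predClosed = predClosed ; word = word
    ; short = ≤-trans (+-monoˡ-≤ (length S) short) (≤-reflexive (cong (length S +_) (sym (+-identityʳ (length S)))))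
    ; fixes = λ x → ones⇒fixedOn predClosed (ones x)
    }
    where open Raising ρ

  ones-run : ∀ {S x} → PredClosed S → (∀ {i} → i ∈ S → lookup x i ≡ true) →
    ∀ w {i} → i ∈ S → lookup (run w x) i ≡ true
  ones-run closed ones w i∈S = trans (run-fixedOn closed (ones⇒fixedOn closed ones) w i∈S) (ones i∈S)

  -- With `S` at 1 throughout, a root at 1 means that all of `K` is at 1, leaves included, and an
  -- all-ones set closed under in-neighbours is stationary. So leaves may be skipped.
  addSkeleton : ∀ {S c L} (ρ : Raising S) (b : Block S) → let open Block b in
    (s : Skeleton _⟶_ r c L) → K ⊆ L → L ⊆ K → Unique L →
    Fixing (suc (c + length S)) (K ++ S)
  addSkeleton {S} ρ b s K⊆L L⊆K uL = assemble {w = word} (B.unique unique) predClosed B.predClosed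
    (Fixing.short (raising⇒fixing ρ)) (≤-trans size (length-mono-⊆ uL L⊆K)) B.size
    (Fixing.fixes (raising⇒fixing ρ)) growth B.scatter B.K⊆M
    λ x t → fixedOn-run B.predClosed (ones⇒fixedOn B.predClosed (ones′ x t)) (spread B.scatter)
    where
    open Raising ρ
    open Skeleton s
    module B = Block b
    ones′ : ∀ x → lookup (run inner (run word x)) B.r ≡ true →
      ∀ {i} → i ∈ B.K ++ S → lookup (run inner (run word x)) i ≡ true
    ones′ x t i∈ with ∈-++⁻ B.K i∈
    ... | inj₁ i∈K = skeleton-true s _ t (K⊆L i∈K)
    ... | inj₂ i∈S = ones-run predClosed (ones x) inner i∈S

  addBranchingBlock : ∀ {S a} → Raising S → (b : Block S) → let open Block b in
    a ≢ r → a ∈ K → a ⟶ r → Fixing (2 + length S) (K ++ S)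
  addBranchingBlock {S} {a} ρ b a≢r a∈K a→r
    with L , (s , L⊆K) , uL , base⊆L , closed ← saturate
           (λ y z → (z ⟶? y) ×-dec (z ∈? Block.K b))
           (λ L → Skeleton _⟶_ (Block.r b) 1 L × L ⊆ Block.K b)
           (λ { (s , sub) y∈L (e , z∈K) z∉L →
                skeleton-step s y∈L e , λ { (here refl) → z∈K ; (there v∈L) → sub v∈L } })
           {a ∷ Block.r b ∷ []}
           -- Initially `r` is inner and `a` is its leaf, which gives one spared update.
           (record { inner = Block.r b ∷ [] ; growth = root
                   ; covered = λ { (here refl) → inj₂ (_ , here refl , a→r) ; (there u∈) → inj₁ u∈ }
                   ; size = ≤-refl }
           , λ { (here refl) → a∈K ; (there (here refl)) → root∈ (Block.gather b) })
           (∷-unique (λ { (here refl) → a≢r refl }) ([] ∷ []))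
    = addSkeleton ρ b s
        (λ v∈K → growth⊆closed (_∈ L) (Block.gather b) (base⊆L (there (here refl)))
                   (λ y∈L e z∈K → closed y∈L (e , z∈K)) v∈K)
        L⊆K uL

  -- The vertex `r` needs no update: at 0 its loop keeps it there, and at 1 all its in-neighbours
  -- are 1. Both its letters are saved.
  addLoop : ∀ {S r} → Raising S → r ∉ S → r ⟶ r → PredClosed (r ∷ S) → Fixing (2 + length S) (r ∷ S)
  addLoop {S} {r} ρ r∉S r→r closed = record
    { unique = ∷-unique r∉S unique ; predClosed = closed ; word = word
    ; short = ≤-trans (+-monoˡ-≤ (2 + length S) short) (≤-reflexive (double (length S)))
    ; fixes = fixed
    }
    where
    open Raising ρ
    double : ∀ s → s + (2 + s) ≡ 2 * suc s
    double = solve-∀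
    fixed : ∀ x → FixedOn (r ∷ S) (run word x)
    fixed x (there i∈S) = ones⇒fixedOn predClosed (ones x) i∈S
    fixed x (here refl) with true-or-false (lookup (run word x) r)
    ... | inj₂ ff = trans (component-false⁺ r→r ff) (sym ff)
    ... | inj₁ t = ones⇒fixedOn closed (λ { (here refl) → t ; (there i∈S) → ones x i∈S }) (here refl)

  -- Without a loop, all in-neighbours of `r` lie in `S` and are already 1, so one update raises it.
  raise : ∀ {S r} → Raising S → r ∉ S → ¬ r ⟶ r → PredClosed (r ∷ S) → Raising (r ∷ S)
  raise {S} {r} ρ r∉S r↛r closed = record
    { unique = ∷-unique r∉S unique ; predClosed = closed ; word = word ++ r ∷ []
    ; short = ≤-trans (≤-reflexive (trans (length-++ word) (+-comm _ 1))) (s≤s short)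
    ; ones = ones′
    }
    where
    open Raising ρ
    ones′ : ∀ x {i} → i ∈ r ∷ S → lookup (run (word ++ r ∷ []) x) i ≡ true
    ones′ x i∈ rewrite run-++ word (r ∷ []) x with i∈
    ... | there i∈S = ones-run {x = run word x} predClosed (ones x) (r ∷ []) i∈S
    ... | here refl = trans (update-self r (run word x)) (component-true⁺ source)
      where
      source : ∀ {j} → j ⟶ r → lookup (run word x) j ≡ true
      source j→r with closed (here refl) j→r
      ... | here refl = contradiction j→r r↛r
      ... | there j∈S = ones x j∈S

  Strong : Set₁
  Strong = Shortens 2 × Connected _⟶_ × Connected (flip _⟶_)

  -- Loopless single vertices are absorbed into `S`. The first block of another kind saves two
  -- letters beyond the `length S` already saved; a third comes from a nonempty `S` or from a later
  -- block, unless this block is the whole network.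
  peel : 3 ≤ n → ∀ m {S} → n ≤ m + length S → Raising S → Shortens 3 ⊎ Strong
  peel 3≤n m {S} bound ρ with full-or-misses S
  ... | inj₁ full = inj₁ (weaken (≤-trans 3≤n (full⇒n≤length full)) (shortens full (raising⇒fixing ρ)))
  peel 3≤n zero bound ρ | inj₂ (v , v∉S) =
    contradiction (unique⇒length≤n (∷-unique v∉S (Raising.unique ρ))) (<⇒≱ (s≤s bound))
  peel 3≤n (suc m) {S} bound ρ | inj₂ (v , v∉S)
    with block (Raising.predClosed ρ) v∉S
  ... | b with first-child (Block.gather b)
  ... | inj₂ (a , a≢r , a∈K , a→r) =
    conclude S b (full-or-misses (Block.K b ++ S)) (addBranchingBlock ρ b a≢r a∈K a→r)
    where
    conclude : ∀ S (b : Block S) → (∀ v → v ∈ Block.K b ++ S) ⊎ (∃[ v ] v ∉ Block.K b ++ S) →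
      Fixing (2 + length S) (Block.K b ++ S) → Shortens 3 ⊎ Strong
    conclude S b (inj₂ (u , u∉)) φ = inj₁ (weaken (s≤s (m≤m+n 2 _)) (complete-proper u∉ φ))
    conclude (_ ∷ _) b (inj₁ full) φ = inj₁ (weaken (m≤m+n 3 _) (shortens full φ))
    conclude [] b (inj₁ full) φ = inj₂
      ( shortens full φ
      , spanning⇒connected gather scatter full′ (K⊆M ∘ full′)
      , spanning⇒connected scatter gather (K⊆M ∘ full′) full′ )
      where
      open Block b
      full′ : ∀ v → v ∈ K
      full′ v = [ id , (λ ()) ]′ (∈-++⁻ K (full v))
  ... | inj₁ eq = singleton eq
    where
    open Block b
    r∉S : r ∉ S
    r∉S = disjoint (root∈ gather)
    singleton : K ≡ r ∷ [] → Shortens 3 ⊎ Strong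
    singleton eq with subst (λ K → PredClosed (K ++ S)) eq predClosed | r ⟶? r
    ... | closed | no r↛r =
      peel 3≤n m (≤-trans bound (≤-reflexive (sym (+-suc m _)))) (raise ρ r∉S r↛r closed)
    ... | closed | yes r→r = inj₁ (conclude S (addLoop ρ r∉S r→r closed))
      where
      conclude : ∀ S′ → Fixing (2 + length S′) (r ∷ S′) → Shortens 3
      conclude S′ φ with full-or-misses (r ∷ S′)
      ... | inj₂ (u , u∉) = weaken (s≤s (m≤m+n 2 _)) (complete-proper u∉ φ)
      conclude (_ ∷ _) φ | inj₁ full = weaken (m≤m+n 3 _) (shortens full φ)
      conclude [] φ | inj₁ full = contradiction (≤-trans 3≤n (full⇒n≤length full)) λ { (s≤s ()) }

  -- Strongly connected networks

  module _ (3≤n : 3 ≤ n) (conn⁺ : Connected _⟶_) (conn⁻ : Connected (flip _⟶_)) where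

    private
      short⇒¬full : ∀ {L} → length L ≤ 2 → ¬ (∀ (v : Fin n) → v ∈ L)
      short⇒¬full short full =
        contradiction (≤-trans 3≤n (≤-trans (full⇒n≤length full) short)) λ { (s≤s (s≤s ())) }

    spanning : {R : Digraph n} → Decidable R → Connected R → ∀ r →
      ∃[ L ] Growth R r L × (∀ v → v ∈ L)
    spanning R? conn r
      with L , g , _ , base⊆L , closed ← saturate R? (Growth _ r) grow root ([] ∷ [])
      = L , g , conn (_∈ L) (base⊆L (here refl)) closed

    neighbour : {R : Digraph n} → Decidable R → Connected R → ∀ r → ∃[ a ] a ≢ r × R r a
    neighbour R? conn r with L , g , full ← spanning R? conn r | first-child g
    ... | inj₂ (a , a≢r , _ , e) = a , a≢r , e
    ... | inj₁ refl = contradiction full (short⇒¬full (s≤s z≤n))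

    predClosed-full : PredClosed (allFin n ++ [])
    predClosed-full {z = z} _ _ = ∈-++⁺ˡ (∈-allFin z)

    assemble-full : ∀ {r I M c} → length I + c ≤ n →
      Growth (flip _⟶_) r I → (o : Growth _⟶_ r M) → (∀ v → v ∈ M) →
      (∀ x → lookup (run I x) r ≡ true → FixedOn (allFin n ++ []) (run (spread o) (run I x))) →
      Shortens (suc c)
    assemble-full {c = c} I≤ g o full good = weaken (≤-reflexive (cong suc (sym (+-identityʳ c))))
      (shortens (λ v → ∈-++⁺ˡ (∈-allFin v)) (assemble {S = []} {K = allFin n} {w = []}
        (Unique.++⁺ (Unique.allFin⁺ n) [] λ ()) (λ ()) predClosed-full z≤n
        (≤-trans I≤ n≤) (≤-trans (unique⇒length≤n (growth-unique o)) n≤)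
        (λ _ ()) g o (λ _ → full _) good))
      where
      n≤ : n ≤ length (allFin n)
      n≤ = full⇒n≤length ∈-allFin

    -- The skeleton starts with `v` inner and with `a` and `b` as leaves; with the root spared in
    -- scattering this makes three letters.
    two-sources : ∀ {v a b} → a ≢ v → b ≢ v → a ≢ b → a ⟶ v → b ⟶ v → Shortens 3
    two-sources {v} {a} {b} a≢v b≢v a≢b a→v b→v
      with M , o , full ← spanning _⟶?_ conn⁺ v
         | L , s , uL , base⊆L , closed ← saturate (flip _⟶?_) (Skeleton _⟶_ v 2)
             (λ s y∈L e _ → skeleton-step s y∈L e)
             {b ∷ a ∷ v ∷ []}
             (record { inner = v ∷ [] ; growth = root
                     ; covered = λ { (here refl) → inj₂ (_ , here refl , b→v)
                                   ; (there (here refl)) → inj₂ (_ , here refl , a→v)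
                                   ; (there (there u∈)) → inj₁ u∈ }
                     ; size = ≤-refl })
             (∷-unique (λ { (here refl) → a≢b refl ; (there (here refl)) → b≢v refl })
               (∷-unique (λ { (here refl) → a≢v refl }) ([] ∷ [])))
      = assemble-full (≤-trans (Skeleton.size s) (unique⇒length≤n uL)) (Skeleton.growth s) o full
          λ x t → fixedOn-run predClosed-full
            (ones⇒fixedOn predClosed-full λ {i} _ → skeleton-true s x t
              (conn⁻ (_∈ L) (base⊆L (here refl)) closed i)) (spread o)

    -- v only copies r: its own value can be ignored while gathering at r, and scattering from r
    -- overwrites it first.
    copy : ∀ {v r} → ¬ v ⟶ v → r ⟶ v → (∀ {a} → a ⟶ v → a ≡ r) → Shortens 3
    copy {v} {r} v↛v r→v only
      with anyFin? (λ a → ¬? (a ≟ r) ×-dec ¬? (a ≟ v) ×-dec (a ⟶? r))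
    -- If `r` had no in-neighbour besides `r` and `v`, these two vertices would be closed under
    -- in-neighbours, against `3 ≤ n`.
    ... | no none = ⊥-elim (short⇒¬full {r ∷ v ∷ []} ≤-refl
            (conn⁻ (_∈ r ∷ v ∷ []) (here refl) closed))
      where
      closed : Closed (flip _⟶_) (_∈ r ∷ v ∷ [])
      closed {z = z} (here refl) z→r with z ≟ r | z ≟ v
      ... | yes refl | _ = here refl
      ... | no _ | yes refl = there (here refl)
      ... | no z≢r | no z≢v = contradiction (z , z≢r , z≢v , z→r) none
      closed (there (here refl)) z→v = here (only z→v)
    ... | yes (a , a≢r , a≢v , a→r)
      with L , (s , v∉L) , uL , base⊆L , closed ← saturate
             (λ y z → (z ⟶? y) ×-dec ¬? (z ≟ v))
             (λ L → Skeleton _⟶_ r 1 L × v ∉ L)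
             (λ { (s , v∉L) y∈L (e , z≢v) z∉L →
                  skeleton-step s y∈L e , λ { (here refl) → z≢v refl ; (there v∈L) → v∉L v∈L } })
             {a ∷ r ∷ []}
             (record { inner = r ∷ [] ; growth = root
                     ; covered = λ { (here refl) → inj₂ (_ , here refl , a→r) ; (there u∈) → inj₁ u∈ }
                     ; size = ≤-refl }
             , λ { (here refl) → a≢v refl ; (there (here refl)) → v↛v r→v })
             (∷-unique (λ { (here refl) → a≢r refl }) ([] ∷ []))
         | M , (o , rest , spread≡) , _ , base⊆M , closedM ← saturate _⟶?_
             (λ M → ∃ λ (o : Growth _⟶_ r M) → ∃[ rest ] spread o ≡ v ∷ rest)
             (λ { (o , rest , eq) y∈M e z∉M →
                  grow o y∈M e z∉M , rest ++ _ ∷ [] , cong (_++ _) eq })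
             {v ∷ r ∷ []}
             -- The scattering tree starts with the edge from `r` to `v`, so its word begins with
             -- `v`.
             (grow root (here refl) r→v (λ { (here refl) → v↛v r→v }) , [] , refl)
             (∷-unique (λ { (here refl) → v↛v r→v }) ([] ∷ []))
      = assemble-full
          -- Gathering spares two updates: one leaf, and `v`, which lies outside `L`.
          (≤-trans (≤-reflexive (+-suc _ 1))
            (≤-trans (s≤s (Skeleton.size s)) (unique⇒length≤n (∷-unique v∉L uL))))
          (Skeleton.growth s) o (conn⁺ (_∈ M) (base⊆M (here refl)) closedM)
          λ x t → subst (λ w → FixedOn _ (run w (run (Skeleton.inner s) x))) (sym spread≡)
            (fixedOn-run predClosed-full
              (ones⇒fixedOn predClosed-full λ {i} _ → ones x t i) rest)
      where
      covers : ∀ u → u ≡ v ⊎ u ∈ L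
      covers = conn⁻ (λ u → u ≡ v ⊎ u ∈ L) (inj₁ refl) step
        where
        step : Closed (flip _⟶_) (λ u → u ≡ v ⊎ u ∈ L)
        step (inj₁ refl) z→v with refl ← only z→v = inj₂ (base⊆L (there (here refl)))
        step {z = z} (inj₂ y∈L) z→y with z ≟ v
        ... | yes z≡v = inj₁ z≡v
        ... | no z≢v = inj₂ (closed y∈L (z→y , z≢v))
      ones : ∀ x → lookup (run (Skeleton.inner s) x) r ≡ true →
        ∀ i → lookup (update f v (run (Skeleton.inner s) x)) i ≡ true
      ones x t i with i ≟ v | covers i
      ... | yes refl | _ = trans (update-self v (run (Skeleton.inner s) x)) (component-true⁺ λ j→v →
              subst (λ j → lookup (run (Skeleton.inner s) x) j ≡ true) (sym (only j→v)) t)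
      ... | no i≢v | inj₁ i≡v = contradiction i≡v i≢v
      ... | no i≢v | inj₂ i∈L = trans (update-other i≢v (run (Skeleton.inner s) x)) (skeleton-true s x t i∈L)

    -- Recognising the looped cycle.

    module _ (loop : ∀ v → v ⟶ v)
      (uniq : ∀ {v a b} → a ≢ v → b ≢ v → a ⟶ v → b ⟶ v → a ≡ b) where

      Chain : List (Fin n) → Set
      Chain L = ∀ a b → toℕ b ≡ suc (toℕ a) → List.lookup L a ⟶ List.lookup L b

      EndsWith : Fin n → List (Fin n) → Set
      EndsWith r L = ∀ a → suc (toℕ a) ≡ length L → List.lookup L a ≡ r

      -- The entry before `q` is already an in-neighbour other than the entry at `q`, and `uniq`
      -- allows no second one.
      previous : ∀ {L} → Chain L → Unique L → ∀ {q} (q′ : Fin (length L)) {z} → toℕ q ≡ suc (toℕ q′) →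
        z ⟶ List.lookup L q → z ≢ List.lookup L q → z ≡ List.lookup L q′
      previous chain u {q} q′ eq z→ z≢ = uniq z≢
        (λ same → 1+n≢n (trans (sym eq) (cong toℕ (sym (lookup-injective u q′ q same)))))
        z→ (chain q′ q eq)

      -- The vertex `y` must be the head: any later entry has its only other in-neighbour in the
      -- list, whereas `z` is new.
      extend-chain : ∀ {L y z} → Chain L → Unique L → y ∈ L → z ⟶ y → z ∉ L → Chain (z ∷ L)
      extend-chain {l ∷ L} {y} {z} chain u y∈L z→y z∉L = chain′
        where
        headed : z ⟶ l
        headed with index y∈L in eq | lookup-index y∈L
        ... | Fin.zero | refl = z→y
        ... | Fin.suc q | refl = contradiction
          (subst (_∈ l ∷ L) (sym (previous chain u (inject₁ q)
             (cong suc (sym (toℕ-inject₁ q))) z→y λ { refl → z∉L y∈L })) (∈-lookup (inject₁ q)))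
          z∉L
        chain′ : Chain (z ∷ l ∷ L)
        chain′ Fin.zero (Fin.suc Fin.zero) _ = headed
        chain′ (Fin.suc a) (Fin.suc b) e = chain a b (suc-injective e)

      extend-end : ∀ {r L y z} → EndsWith r L → y ∈ L → EndsWith r (z ∷ L)
      extend-end {L = _ ∷ _} ends _ Fin.zero ()
      extend-end ends _ (Fin.suc a) e = ends a (suc-injective e)

      -- The last vertex `r` has an out-neighbour `w` other than itself. If `w` were not the head,
      -- `r` would be the entry just before `w`, hence not the last.
      closing-edge : ∀ {r l L} → Chain (l ∷ L) → EndsWith r (l ∷ L) → Unique (l ∷ L) →
        (∀ v → v ∈ l ∷ L) → r ⟶ l
      closing-edge {r} {l} {L} chain ends u full
        with w , w≢r , r→w ← neighbour _⟶?_ conn⁺ r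
        with index (full w) | lookup-index (full w)
      ... | Fin.zero | refl = r→w
      ... | Fin.suc q | refl = contradiction
        (trans (sym (toℕ-fromℕ (length L))) (trans (cong toℕ last≡q) (toℕ-inject₁ q)))
        (<⇒≢ (toℕ<n q) ∘ sym)
        where
        last≡q : fromℕ (length L) ≡ inject₁ q
        last≡q = lookup-injective u _ _ (trans
          (ends (fromℕ (length L)) (cong suc (toℕ-fromℕ (length L))))
          (previous chain u (inject₁ q) (cong suc (sym (toℕ-inject₁ q))) r→w (w≢r ∘ sym)))

      cyclic : ∃[ L ] Unique L × (∀ v → v ∈ L) ×
        (∀ a b → Cycle (length L) a b → List.lookup L a ⟶ List.lookup L b)
      cyclic
        with r ← fromℕ< {0} (≤-trans (s≤s z≤n) 3≤n)
        with saturate (flip _⟶?_) (λ L → Chain L × EndsWith r L × Unique L)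
               (λ { (chain , ends , u) y∈L e z∉L →
                    extend-chain chain u y∈L e z∉L , extend-end ends y∈L , ∷-unique z∉L u })
               {r ∷ []}
               ((λ { Fin.zero Fin.zero () }) , (λ { Fin.zero _ → refl }) , [] ∷ []) ([] ∷ [])
      ... | [] , _ , _ , base⊆L , _ = contradiction (base⊆L (here refl)) λ ()
      ... | l ∷ L , (chain , ends , u) , _ , base⊆L , closed = l ∷ L , u , full , edge
        where
        full : ∀ v → v ∈ l ∷ L
        full = conn⁻ (_∈ l ∷ L) (base⊆L (here refl)) closed
        edge : ∀ a b → Cycle (length (l ∷ L)) a b → List.lookup (l ∷ L) a ⟶ List.lookup (l ∷ L) b
        edge a b (inj₁ e) = chain a b e
        edge a Fin.zero (inj₂ (e , _)) =
          subst (_⟶ l) (sym (ends a e)) (closing-edge chain ends u full)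

      ≅LoopedCycle : interactionGraph f ≅ LoopedCycle n
      ≅LoopedCycle with L , u , full , edge ← cyclic = σ , iso
        where
        size : length L ≡ n
        size = ≤-antisym (unique⇒length≤n u) (full⇒n≤length full)
        position : Fin n → Fin (length L)
        position v = index (full v)
        at-position : ∀ v → v ≡ List.lookup L (position v)
        at-position v = lookup-index (full v)
        position-lookup : ∀ k → position (List.lookup L k) ≡ k
        position-lookup k = lookup-injective u _ _ (sym (at-position (List.lookup L k)))

        σ : Permutation′ n
        σ = permutation (cast size ∘ position) (List.lookup L ∘ cast (sym size))
          (λ k → trans (cong (cast size) (position-lookup _)) (cast-involutive size (sym size) k))
          (λ v → trans (cong (List.lookup L) (cast-involutive (sym size) size (position v)))
                       (sym (at-position v)))

        to : ∀ i j → i ⟶ j → LoopedCycle (length L) (position i) (position j)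
        to i j i→j with i ≟ j
        ... | yes refl = inj₂ refl
        -- The cyclic predecessor of `j` is an in-neighbour other than `j`, so by `uniq` it is `i`.
        ... | no i≢j with p , p↝j ← cycle-pred (position j) = inj₁ (subst
            (λ k → Cycle (length L) k (position j))
            (sym (trans (cong position i≡) (position-lookup p))) p↝j)
          where
          p→j : List.lookup L p ⟶ j
          p→j = subst (_ ⟶_) (sym (at-position j)) (edge p (position j) p↝j)
          p≢j : List.lookup L p ≢ j
          p≢j refl = cycle-irrefl (≤-trans (s≤s (s≤s z≤n)) (≤-trans 3≤n (≤-reflexive (sym size))))
            (subst 
              (λ k → Cycle (length L) k (position (List.lookup L p))) (sym (position-lookup p)) p↝j)
          i≡ : i ≡ List.lookup L p
          i≡ = uniq i≢j p≢j i→j p→j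

        from : ∀ i j → LoopedCycle (length L) (position i) (position j) → i ⟶ j
        from i j (inj₁ c) = subst₂ _⟶_ (sym (at-position i)) (sym (at-position j)) (edge _ _ c)
        from i j (inj₂ same) = subst (i ⟶_)
          (trans (at-position i) (trans (cong (List.lookup L) same) (sym (at-position j)))) (loop i)

        iso : ∀ i j → interactionGraph f i j ⇔ LoopedCycle n (σ ⟨$⟩ʳ i) (σ ⟨$⟩ʳ j)
        iso i j = mk⇔
          (cast-loopedCycle size .Equivalence.to ∘ to i j ∘ ⟶⇔interactionGraph i j .Equivalence.from)
          (⟶⇔interactionGraph i j .Equivalence.to ∘ from i j ∘ cast-loopedCycle size .Equivalence.from)

    shortens-or-≅ : Shortens 3 ⊎ interactionGraph f ≅ LoopedCycle n
    shortens-or-≅ with anyFin? (λ v → anyFin? λ a → anyFin? λ b → ¬? (a ≟ v) ×-dec ¬? (b ≟ v)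
                          ×-dec ¬? (a ≟ b) ×-dec (a ⟶? v) ×-dec (b ⟶? v))
    ... | yes (v , a , b , a≢v , b≢v , a≢b , a→v , b→v) =
      inj₁ (two-sources a≢v b≢v a≢b a→v b→v)
    ... | no none = by-loops
      where
      uniq : ∀ {v a b} → a ≢ v → b ≢ v → a ⟶ v → b ⟶ v → a ≡ b
      uniq {v} {a} {b} a≢v b≢v a→v b→v = decidable-stable (a ≟ b) λ a≢b →
        none (v , a , b , a≢v , b≢v , a≢b , a→v , b→v)
      by-loops : Shortens 3 ⊎ interactionGraph f ≅ LoopedCycle n
      by-loops with anyFin? (λ v → ¬? (v ⟶? v))
      ... | no all = inj₂ (≅LoopedCycle
        (λ v → decidable-stable (v ⟶? v) λ v↛v → all (v , v↛v)) uniq)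
      ... | yes (v , v↛v) with r , r≢v , r→v ← neighbour (flip _⟶?_) conn⁻ v =
        inj₁ (copy v↛v r→v λ a→v → uniq (λ { refl → v↛v a→v }) r≢v a→v r→v)

  upper-bound : 3 ≤ n → Shortens 3 ⊎ Shortens 2 × interactionGraph f ≅ LoopedCycle n
  upper-bound 3≤n with peel 3≤n n (m≤m+n n _) (record
    { unique = [] ; predClosed = λ () ; word = [] ; short = z≤n ; ones = λ _ () })
  ... | inj₁ s = inj₁ s
  ... | inj₂ (s , conn⁺ , conn⁻) with shortens-or-≅ 3≤n conn⁺ conn⁻
  ... | inj₁ s′ = inj₁ s′
  ... | inj₂ iso = inj₂ (s , iso)

  -- Lower bound for the looped cycle

  -- Reading stops at the letter that completes the alphabet; `u` is the part read so far, still
  -- incomplete.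
  latest-letter : (u w : List (Fin n)) → (∃[ j ] j ∉ u) → (∃[ j ] j ∉ u ++ w) ⊎
    ∃[ p ] ∃[ j ] ∃[ v ] u ++ w ≡ p ++ j ∷ v × j ∉ p × (∀ k → k ∈ j ∷ p)
  latest-letter u [] (j , j∉u) = inj₁ (j , [ j∉u , (λ ()) ]′ ∘ ∈-++⁻ u)
  latest-letter u (i ∷ w) (j , j∉u) with full-or-misses (i ∷ u)
  ... | inj₁ full with full j
  ... | there j∈u = contradiction j∈u j∉u
  ... | here refl = inj₂ (u , i , w , refl , j∉u , full)
  latest-letter u (i ∷ w) _ | inj₂ (k , k∉) =
    subst (λ w′ → (∃[ j ] j ∉ w′) ⊎ ∃[ p ] ∃[ j ] ∃[ v ] w′ ≡ p ++ j ∷ v × j ∉ p × (∀ k → k ∈ j ∷ p))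
      (++-assoc u (i ∷ []) w)
      (latest-letter (u ++ i ∷ []) w
        (k , λ k∈ → k∉ ([ there , (λ { (here refl) → here refl }) ]′ (∈-++⁻ u k∈))))

  module _ (2≤n : 2 ≤ n) (iso : interactionGraph f ≅ LoopedCycle n) where

    private
      σ : Permutation′ n
      σ = proj₁ iso

    _↝_ : Digraph n
    i ↝ j = Cycle n (σ ⟨$⟩ʳ i) (σ ⟨$⟩ʳ j)

    σ-injective : ∀ {i j} → σ ⟨$⟩ʳ i ≡ σ ⟨$⟩ʳ j → i ≡ j
    σ-injective eq = trans (sym (inverseˡ σ)) (trans (cong (σ ⟨$⟩ˡ_) eq) (inverseˡ σ))

    ↝⇒⟶ : ∀ {i j} → i ↝ j → i ⟶ j
    ↝⇒⟶ i↝j = ⟶⇔interactionGraph _ _ .Equivalence.from (proj₂ iso _ _ .Equivalence.from (inj₁ i↝j))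

    self-loop : ∀ i → i ⟶ i
    self-loop i = ⟶⇔interactionGraph i i .Equivalence.from (proj₂ iso i i .Equivalence.from (inj₂ refl))

    ⟶⇒↝ : ∀ {i j} → i ⟶ j → i ≢ j → i ↝ j
    ⟶⇒↝ {i} {j} i→j i≢j
      with proj₂ iso i j .Equivalence.to (⟶⇔interactionGraph i j .Equivalence.to i→j)
    ... | inj₁ i↝j = i↝j
    ... | inj₂ same = contradiction (σ-injective same) i≢j

    ↝-out-unique : ∀ {p j k} → p ↝ j → p ↝ k → j ≡ k
    ↝-out-unique p↝j p↝k = σ-injective (cycle-out-unique p↝j p↝k)

    ↝-pred : ∀ j → ∃[ p ] p ↝ j
    ↝-pred j with q , q↝ ← cycle-pred (σ ⟨$⟩ʳ j) =
      σ ⟨$⟩ˡ q , subst (λ k → Cycle n k (σ ⟨$⟩ʳ j)) (sym (inverseʳ σ)) q↝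

    ↝-connected : Connected _↝_
    ↝-connected C Cv closed u = subst C (inverseˡ σ) (cycle-connected (λ k → C (σ ⟨$⟩ˡ k))
      (subst C (sym (inverseˡ σ)) Cv)
      (λ Cy y↝z → closed Cy (subst₂ (Cycle n) (sym (inverseʳ σ)) (sym (inverseʳ σ)) y↝z))
      (σ ⟨$⟩ʳ u))

    Sole : Fin n → State n → Set
    Sole p x = lookup x p ≡ false × (∀ {k} → k ≢ p → lookup x k ≡ true)

    sole-initial : ∀ p → Sole p (replicate n true [ p ]≔ false)
    sole-initial p = lookup∘update p (replicate n true) false ,
      λ {k} k≢p → trans (lookup∘update′ k≢p (replicate n true) false) (lookup-replicate k true)

    -- Every vertex has a loop, so a 0 is never lost.
    false-run : ∀ {p} w x → lookup x p ≡ false → lookup (run w x) p ≡ false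
    false-run [] x xp = xp
    false-run {p} (k ∷ w) x xp = false-run w (update f k x) step
      where
      step : lookup (update f k x) p ≡ false
      step with p ≟ k
      ... | yes refl = trans (update-self p x) (component-false⁺ (self-loop p) xp)
      ... | no p≢k = trans (update-other p≢k x) xp

    -- The 0 at `p` is read only by `p` and its successor `j`.
    sole-run : ∀ {p j} → p ↝ j → ∀ w → j ∉ w → ∀ x → Sole p x → Sole p (run w x)
    sole-run _ [] _ x sole = sole
    sole-run {p} {j} p↝j (k ∷ w) j∉ x (xp , ones) =
      sole-run p↝j w (j∉ ∘ there) (update f k x) (false-run (k ∷ []) x xp , ones′)
      where
      ones′ : ∀ {i} → i ≢ p → lookup (update f k x) i ≡ true
      ones′ {i} i≢p with i ≟ k
      ... | no i≢k = trans (update-other i≢k x) (ones i≢p)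
      ... | yes refl = trans (update-self i x) (component-true⁺ λ {l} l→i → ones λ { refl →
              j∉ (here (↝-out-unique p↝j (⟶⇒↝ l→i (i≢p ∘ sym)))) })

    -- In a fixed point a 0 passes along each edge of the cycle, hence all around.
    fixedPoint-false : ∀ {y p} → FixedPoint f y → lookup y p ≡ false → ∀ u → lookup y u ≡ false
    fixedPoint-false {y} fixed yp = ↝-connected (λ u → lookup y u ≡ false) yp
      λ {_} {z} ya a↝z → trans (sym (cong (λ s → lookup s z) fixed)) (component-false⁺ (↝⇒⟶ a↝z) ya)

    lower-bound : ∀ w → Fixes w f → 2 * n ≤ length w + 2
    lower-bound w fixes
      with latest-letter [] w (fromℕ< {0} (≤-trans (s≤s z≤n) 2≤n) , λ ())
    ... | inj₁ (j , j∉w) with p , p↝j ← ↝-pred j =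
      -- Without `j` the word leaves 1 at `j`, yet a fixed point with a 0 at `p` has 0 there too.
      true≢false (proj₂ sole λ { refl → cycle-irrefl 2≤n p↝j })
        (fixedPoint-false (fixes x) (proj₁ sole) j)
      where
      x : State n
      x = replicate n true [ p ]≔ false
      sole : Sole p (run w x)
      sole = sole-run p↝j w j∉w x (sole-initial p)
    ... | inj₂ (u , j , v , refl , j∉u , full) with p , p↝j ← ↝-pred j = begin
        2 * n
          ≡⟨ cong (n +_) (+-identityʳ n) ⟩
        n + n
          -- The 2 arises because `j` is counted in both lists and `p` is added to the second.
          ≤⟨ +-mono-≤ (full⇒n≤length full) (full⇒n≤length touched) ⟩
        suc (length u) + suc (suc (length v))
          ≡⟨ regroup (length u) (length v) ⟩
        length u + suc (length v) + 2
          ≡⟨ cong (_+ 2) (sym (length-++ u)) ⟩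
        length (u ++ j ∷ v) + 2 ∎
      where
      open ≤-Reasoning
      regroup : ∀ a b → suc a + suc (suc b) ≡ a + suc b + 2
      regroup = solve-∀
      x : State n
      x = replicate n true [ p ]≔ false
      sole : Sole p (run u x)
      sole = sole-run p↝j u j∉u x (sole-initial p)
      -- After `u` every vertex but `p` is at 1, while the final fixed point is all 0, so each of
      -- them is still to be updated.
      touched : ∀ k → k ∈ p ∷ j ∷ v
      touched k with k ∈? (p ∷ j ∷ v)
      ... | yes k∈ = k∈
      ... | no k∉ = true≢false
        (trans (run-other (j ∷ v) (k∉ ∘ there) (run u x)) (proj₂ sole (k∉ ∘ here)))
        (subst (λ y → lookup y k ≡ false) (run-++ u (j ∷ v) x)
          (fixedPoint-false (fixes x)
            (false-run (u ++ j ∷ v) x (proj₁ (sole-initial p))) k))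

  -- Existence of the minimal length, and the equality case.

  fixes? : ∀ w → Dec (Fixes w f)
  fixes? w = allStates? λ x → ≡-dec Bool._≟_ (f (run w x)) (run w x)

  -- Fixing is decidable and there are finitely many words of each length, so a search up to the
  -- length of `w` finds the least one.
  minimal-fixing : ∀ w → Fixes w f → ∃[ k ] FixingLength f k
  minimal-fixing w fixes
    with k , (w′ , fixes′ , refl) , least ← minimum (λ k → anyWord? k fixes?) _ (w , fixes , refl)
    = k , (w′ , fixes′ , refl) , λ v fixes-v → least _ (v , fixes-v , refl)

theorem12 : (n : ℕ) → 3 ≤ n → (f : Network n) → Conjunctive f →
    ∃[ k ] FixingLength f k
    × k ≤ 2 * n ∸ 2
    × (k ≡ 2 * n ∸ 2 ⇔ interactionGraph f ≅ LoopedCycle n)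
theorem12 n 3≤n f conj = conclude (upper-bound f conj 3≤n)
  where
  2≤2n : 2 ≤ 2 * n
  2≤2n = ≤-trans (n≤1+n 2) (≤-trans 3≤n (m≤m+n n _))

  conclude : Shortens f conj 3 ⊎ Shortens f conj 2 × interactionGraph f ≅ LoopedCycle n →
    ∃[ k ] FixingLength f k × k ≤ 2 * n ∸ 2 × (k ≡ 2 * n ∸ 2 ⇔ interactionGraph f ≅ LoopedCycle n)
  conclude upper
    with w , fixes , short ← [ weaken f conj (n≤1+n 2) , proj₁ ]′ upper
    with k , fixing@((w′ , fixes′ , length≡) , least) ← minimal-fixing f conj w fixes
    = k , fixing , k≤ , mk⇔ (to upper) from
    where
    k≤ : k ≤ 2 * n ∸ 2
    k≤ = m+n≤o⇒m≤o∸n k (≤-trans (+-monoˡ-≤ 2 (least w fixes)) short)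

    to : Shortens f conj 3 ⊎ Shortens f conj 2 × interactionGraph f ≅ LoopedCycle n →
      k ≡ 2 * n ∸ 2 → interactionGraph f ≅ LoopedCycle n
    to (inj₂ (_ , iso)) _ = iso
    -- Three saved letters put `k` strictly below `2 * n ∸ 2`; the subtraction is exact by `2≤2n`.
    to (inj₁ (v , fixes-v , short-v)) k≡ = contradiction
      (≤-trans (+-monoˡ-≤ 3 (least v fixes-v)) short-v)
      (<⇒≱ (≤-reflexive (trans (cong suc (sym (m∸n+n≡m 2≤2n)))
                        (trans (cong (λ m → suc (m + 2)) (sym k≡)) (sym (+-suc k 2))))))

    from : interactionGraph f ≅ LoopedCycle n → k ≡ 2 * n ∸ 2
    from iso = ≤-antisym k≤
      (≤-trans (∸-monoˡ-≤ 2 (lower-bound f conj (≤-trans (n≤1+n 2) 3≤n) iso w′ fixes′))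
               (≤-reflexive (trans (m+n∸n≡m (length w′) 2) length≡)))
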